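{- Let $n\geq 3$ and let $G$ be an edge-colored $K^{(3)}_{n,n,n}$ with partite sets $V_1,V_2,V_3$, containing no rainbow copy of $\mathcal{L}$, with $|C(G)|\geq 3$. Then, after renumbering the colors if necessary, at least one of the following holds: (i) there exist two vertices $x_1,y_1$ and a color $i\in C(G)$ such that every edge $e$ with $c(e)\neq i$ satisfies $\{x_1,y_1\}\subseteq e$; (ii) $|C(G)|=3$, and there is a unique edge $e$ of color $1$, and every edge $f$ of color $2$ satisfies $|e\cap f|=2$; (iii) $|C(G)|=3$, and there exist five vertices $x_1,y_1,y_2,z_1,z_2$ such that $c(x_1y_1z_1)=c(x_1y_2z_2)=1$, $c(x_1y_1z_2)=c(x_1y_2z_1)=2$, and all remaining edges have color $3$.
   Context: $K^{(3)}_{n,n,n}$ with partite sets $V_1,V_2,V_3$ (disjoint, each of size $n$) is the 3-graph whose edges are all $\{x,y,z\}$ with $x\in V_1,y\in V_2,z\in V_3$. An edge-coloring is any map $c$ from edges to colors; $C(G)$ is the set of colors used; a copy is rainbow if its edges have pairwise distinct colors. The loose path $\mathcal{L}$ is the 3-graph with edges $\{v_1v_2v_3,v_3v_4v_5,v_5v_6v_7\}$. -}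

module Defs where

open import Data.Nat using (ℕ; _+_)
open import Data.Fin using (Fin; zero; suc)
open import Data.Fin.Properties using (_≟_)
open import Data.Sum using (_⊎_)
open import Data.Product using (_×_; _,_; proj₁; proj₂; ∃-syntax)
open import Relation.Nullary using (¬_; yes; no)
open import Relation.Binary.PropositionalEquality using (_≡_; _≢_)
open import Function.Definitions using (Injective)

-- Vertices of K^(3)_{n,n,n}: (p , t) is the t-th vertex of the partite set V_{p+1}.
Vertex : ℕ → Set
Vertex n = Fin 3 × Fin n

part : ∀ {n} → Vertex n → Fin 3
part = proj₁

-- Edges of K^(3)_{n,n,n}: an edge {x,y,z} with x∈V1, y∈V2, z∈V3 is the triple (x,y,z).
Edge : ℕ → Set
Edge n = Fin n × Fin n × Fin n

coord : ∀ {n} → Edge n → Fin 3 → Fin n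
coord (a , b , c) zero = a
coord (a , b , c) (suc zero) = b
coord (a , b , c) (suc (suc zero)) = c

_∋_ : ∀ {n} → Edge n → Vertex n → Set
e ∋ (p , t) = coord e p ≡ t

-- the vertex set of edge e is exactly {u , v , w}
Spans : ∀ {n} → Edge n → Vertex n → Vertex n → Vertex n → Set
Spans e u v w =
  part u ≢ part v × part u ≢ part w × part v ≢ part w × e ∋ u × e ∋ v × e ∋ w

-- |e ∩ f| : number of common vertices (a common vertex lies in some part p,
-- where both edges have the same vertex)
agree : ∀ {n} → Edge n → Edge n → Fin 3 → ℕ
agree e f p with coord e p ≟ coord f p
... | yes _ = 1
... | no _ = 0

∣_∩_∣ : ∀ {n} → Edge n → Edge n → ℕ
∣ e ∩ f ∣ = agree e f zero + agree e f (suc zero) + agree e f (suc (suc zero))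

Coloring : ℕ → Set
Coloring n = Edge n → ℕ

Used : ∀ {n} → Coloring n → ℕ → Set
Used {n} c k = ∃[ e ] c e ≡ k

AtLeast3Colors : ∀ {n} → Coloring n → Set
AtLeast3Colors c = ∃[ a ] ∃[ b ] ∃[ d ]
  (a ≢ b × a ≢ d × b ≢ d × Used c a × Used c b × Used c d)

ColorsAre : ∀ {n} → Coloring n → ℕ → ℕ → ℕ → Set
ColorsAre c a b d = a ≢ b × a ≢ d × b ≢ d × Used c a × Used c b × Used c d
  × (∀ e → c e ≡ a ⊎ (c e ≡ b ⊎ c e ≡ d))

-- Loose path L = {v1v2v3, v3v4v5, v5v6v7}; a copy in G is an injective
-- vertex map v : Fin 7 → V(G) sending each edge of L to an edge of G.
-- Vertex i of the path (1-based) is v (i-1).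
RainbowLoosePath : ∀ {n} → Coloring n → Set
RainbowLoosePath {n} c = ∃[ v ] Injective _≡_ _≡_ v × ∃[ e₁ ] ∃[ e₂ ] ∃[ e₃ ]
  ( Spans e₁ (v v1) (v v2) (v v3)
  × Spans e₂ (v v3) (v v4) (v v5)
  × Spans e₃ (v v5) (v v6) (v v7)
  × c e₁ ≢ c e₂ × c e₁ ≢ c e₃ × c e₂ ≢ c e₃ )
  where
  v1 v2 v3 v4 v5 v6 v7 : Fin 7
  v1 = zero
  v2 = suc zero
  v3 = suc (suc zero)
  v4 = suc (suc (suc zero))
  v5 = suc (suc (suc (suc zero)))
  v6 = suc (suc (suc (suc (suc zero))))
  v7 = suc (suc (suc (suc (suc (suc zero)))))

CaseI : ∀ {n} → Coloring n → Set
CaseI {n} c = ∃[ x₁ ] ∃[ y₁ ] ∃[ i ]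
  (x₁ ≢ y₁ × Used c i × (∀ (e : Edge n) → c e ≢ i → e ∋ x₁ × e ∋ y₁))

-- (ii) with colors 1,2,3 renumbered as a,b,d
CaseII : ∀ {n} → Coloring n → Set
CaseII {n} c = ∃[ a ] ∃[ b ] ∃[ d ] (ColorsAre c a b d × ∃[ e ]
  ( c e ≡ a × (∀ (e' : Edge n) → c e' ≡ a → e' ≡ e)
  × (∀ (f : Edge n) → c f ≡ b → ∣ e ∩ f ∣ ≡ 2)))

-- (iii) with colors 1,2,3 renumbered as a,b,d
CaseIII : ∀ {n} → Coloring n → Set
CaseIII {n} c = ∃[ a ] ∃[ b ] ∃[ d ] (ColorsAre c a b d ×
  ∃[ x₁ ] ∃[ y₁ ] ∃[ y₂ ] ∃[ z₁ ] ∃[ z₂ ] ∃[ e₁₁ ] ∃[ e₂₂ ] ∃[ e₁₂ ] ∃[ e₂₁ ]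
  ( Spans e₁₁ x₁ y₁ z₁ × Spans e₂₂ x₁ y₂ z₂
  × Spans e₁₂ x₁ y₁ z₂ × Spans e₂₁ x₁ y₂ z₁
  × c e₁₁ ≡ a × c e₂₂ ≡ a × c e₁₂ ≡ b × c e₂₁ ≡ b
  × (∀ (f : Edge n) → f ≢ e₁₁ → f ≢ e₂₂ → f ≢ e₁₂ → f ≢ e₂₁ → c f ≡ d)))

{-# OPTIONS --safe #-}
-- In coordinates a loose path is e₁, e₂, e₃ with e₁ and e₃ disjoint and e₂ taking one
-- coordinate from e₁, another from e₃, and the last from neither.  So two disjoint edges of
-- different colors restrict every edge between them to their two colors.
--
-- Some two disjoint edges have different colors; comparing them with an edge of a third color
-- yields edges (u,v,i), (u,v,j) of different colors α, β and an edge (s,t,w) with s ≢ u, t ≢ v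
-- of a third color δ.  Path arguments spread δ to all edges avoiding both u and v, and to all
-- edges containing exactly one of u, v but neither i nor j.  If δ fills everything off the line
-- (u,v,∗), this is (i).  Otherwise, up to symmetry, (u,t,i) ≢ δ for some t ≢ v; it then has
-- color β, so the spreading applies to the line (u,∗,i) as well.  The edge (u,t,j) then decides:
-- color δ gives (ii), and otherwise it has color α, which gives (iii).
module Submission where

open import Defs
open import Data.Fin using (Fin; zero; suc; punchIn; punchOut)
open import Data.Fin.Properties using (_≟_; any?; punchIn-punchOut; punchIn-injective; punchInᵢ≢i)
open import Data.Vec using (Vec; []; _∷_; lookup)
open import Data.Vec.Relation.Unary.All using ([]; _∷_)
open import Data.Vec.Relation.Unary.AllPairs using ([]; _∷_)
open import Data.Vec.Relation.Unary.Unique.Propositional using (Unique)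
open import Data.Vec.Relation.Unary.Unique.Propositional.Properties using (lookup-injective)
open import Data.Nat using (ℕ; _≥_; s≤s; _+_)
import Data.Nat.Properties as ℕ
open import Data.Product using (_×_; _,_; proj₁; proj₂; ∃-syntax)
open import Data.Sum using (_⊎_; inj₁; inj₂)
open import Function using (_∘_)
open import Relation.Nullary using (¬_; yes; no; contradiction)
open import Relation.Nullary.Decidable using (¬?; _×-dec_)
open import Relation.Binary.PropositionalEquality
  using (_≡_; _≢_; refl; sym; trans; cong; cong₂; subst; ≢-sym)

-- Auxiliary facts on vertices and colors.

fresh : ∀ {n} → n ≥ 3 → (i j : Fin n) → ∃[ k ] (k ≢ i × k ≢ j)
fresh (s≤s (s≤s (s≤s _))) i j with i ≟ j
... | yes refl = punchIn i zero , punchInᵢ≢i i zero , punchInᵢ≢i i zero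
... | no i≢j = punchIn i (punchIn j′ zero) , punchInᵢ≢i i _ ,
  λ eq → punchInᵢ≢i j′ zero (punchIn-injective i _ _ (trans eq (sym (punchIn-punchOut i≢j))))
  where j′ = punchOut i≢j

locate : ∀ {n} (k i j : Fin n) → k ≡ i ⊎ k ≡ j ⊎ (k ≢ i × k ≢ j)
locate k i j with k ≟ i | k ≟ j
... | yes p | _     = inj₁ p
... | no _  | yes q = inj₂ (inj₁ q)
... | no p  | no q  = inj₂ (inj₂ (p , q))

agree-≡ : ∀ {n} {e f : Edge n} p → coord e p ≡ coord f p → agree e f p ≡ 1
agree-≡ {e = e} {f} p eq with coord e p ≟ coord f p
... | yes _ = refl
... | no ne = contradiction eq ne

agree-≢ : ∀ {n} {e f : Edge n} p → coord e p ≢ coord f p → agree e f p ≡ 0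
agree-≢ {e = e} {f} p ne with coord e p ≟ coord f p
... | yes eq = contradiction eq ne
... | no _ = refl

Rainbow₃ : ℕ → ℕ → ℕ → Set
Rainbow₃ k l m = k ≢ l × k ≢ m × l ≢ m

middle-color : ∀ {k l m} → ¬ Rainbow₃ k l m → k ≢ m → l ≡ k ⊎ l ≡ m
middle-color {k} {l} {m} ¬r k≢m with l ℕ.≟ k | l ℕ.≟ m
... | yes p | _     = inj₁ p
... | no _  | yes q = inj₂ q
... | no p  | no q  = contradiction (≢-sym p , k≢m , q) ¬r

last-color : ∀ {k l m} → ¬ Rainbow₃ k l m → k ≢ l → m ≡ k ⊎ m ≡ l
last-color ¬r = middle-color λ { (k≢m , k≢l , m≢l) → ¬r (k≢l , k≢m , ≢-sym m≢l) }

-- The device behind most coloring steps: an edge is placed in two loose paths, each with a known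
-- edge of color δ, one also with an edge of color α and the other with one of color β.
common : ∀ {k α β δ : ℕ} → α ≢ β → k ≡ α ⊎ k ≡ δ → k ≡ β ⊎ k ≡ δ → k ≡ δ
common α≢β (inj₂ p) _ = p
common α≢β (inj₁ _) (inj₂ q) = q
common α≢β (inj₁ p) (inj₁ q) = contradiction (trans (sym p) q) α≢β

-- Permuting the three parts.

-- An order p, q, r of the three parts; mk a b d is the edge with these coordinates in that order.
record Frame (n : ℕ) : Set where
  field
    p q r    : Fin 3
    p≢q      : p ≢ q
    p≢r      : p ≢ r
    q≢r      : q ≢ r
    mk       : Fin n → Fin n → Fin n → Edge n
    coord-p  : ∀ {a b d} → coord (mk a b d) p ≡ a
    coord-q  : ∀ {a b d} → coord (mk a b d) q ≡ b
    coord-r  : ∀ {a b d} → coord (mk a b d) r ≡ d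
    mk-coord : ∀ e → mk (coord e p) (coord e q) (coord e r) ≡ e
    ∩-agree  : ∀ (e f : Edge n) → ∣ e ∩ f ∣ ≡ agree e f p + agree e f q + agree e f r

open Frame

standard : ∀ {n} → Frame n
standard = record
  { p = zero ; q = suc zero ; r = suc (suc zero)
  ; p≢q = λ () ; p≢r = λ () ; q≢r = λ ()
  ; mk = λ a b d → a , b , d
  ; coord-p = refl ; coord-q = refl ; coord-r = refl
  ; mk-coord = λ _ → refl
  ; ∩-agree = λ _ _ → refl
  }

-- Together with `swap₂₃` this generates all six orders of the parts, so each argument is written
-- for one arrangement only.
swap₁₂ : ∀ {n} → Frame n → Frame n
swap₁₂ F = record
  { p = q F ; q = p F ; r = r F
  ; p≢q = ≢-sym (p≢q F) ; p≢r = q≢r F ; q≢r = p≢r F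
  ; mk = λ a b d → mk F b a d
  ; coord-p = coord-q F ; coord-q = coord-p F ; coord-r = coord-r F
  ; mk-coord = mk-coord F
  ; ∩-agree = λ e f → trans (∩-agree F e f)
      (cong (_+ agree e f (r F)) (ℕ.+-comm (agree e f (p F)) (agree e f (q F))))
  }

swap₂₃ : ∀ {n} → Frame n → Frame n
swap₂₃ F = record
  { p = p F ; q = r F ; r = q F
  ; p≢q = p≢r F ; p≢r = p≢q F ; q≢r = ≢-sym (q≢r F)
  ; mk = λ a b d → mk F a d b
  ; coord-p = coord-p F ; coord-q = coord-r F ; coord-r = coord-q F
  ; mk-coord = mk-coord F
  ; ∩-agree = λ e f → trans (∩-agree F e f)
      (trans (ℕ.+-assoc (agree e f (p F)) (agree e f (q F)) (agree e f (r F)))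
      (trans (cong (agree e f (p F) +_) (ℕ.+-comm (agree e f (q F)) (agree e f (r F))))
             (sym (ℕ.+-assoc (agree e f (p F)) (agree e f (r F)) (agree e f (q F))))))
  }

module _ {n : ℕ} (n≥3 : n ≥ 3) (c : Coloring n) (noPath : ¬ RainbowLoosePath c) where

  private variable
    F : Frame n
    a a′ b b′ d d′ d″ u v i j s t w : Fin n
    a₁ a₂ a₃ b₁ b₂ b₃ d₁ d₂ d₃ : Fin n
    κ μ α β δ : ℕ

  -- Loose paths in coordinates.

  color : Frame n → Fin n → Fin n → Fin n → ℕ
  color F a b d = c (mk F a b d)

  -- Normal form of a loose path: the two joints are (p, a) and (q, b), and in part r all three
  -- edges differ. Changing the frame gives every other loose path.
  path-not-rainbow : ∀ F → a ≢ a′ → b ≢ b′ → d ≢ d′ → d ≢ d″ → d′ ≢ d″ →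
    ¬ Rainbow₃ (color F a b′ d′) (color F a b d) (color F a′ b d″)
  path-not-rainbow {a} {a′} {b} {b′} {d} {d′} {d″} F a≢a′ b≢b′ d≢d′ d≢d″ d′≢d″
    (k≢l , k≢m , l≢m) = noPath
      ( lookup vs , (λ {x} {y} → lookup-injective distinct x y) , _ , _ , _
      , (q≢r F , ≢-sym (p≢q F) , ≢-sym (p≢r F) , coord-q F , coord-r F , coord-p F)
      , (p≢r F , p≢q F , ≢-sym (q≢r F) , coord-p F , coord-r F , coord-q F)
      , (≢-sym (p≢q F) , q≢r F , p≢r F , coord-q F , coord-p F , coord-r F)
      , k≢l , k≢m , l≢m )
    where
    vs : Vec (Vertex n) 7
    vs = (q F , b′) ∷ (r F , d′) ∷ (p F , a) ∷ (r F , d) ∷ (q F , b) ∷ (p F , a′) ∷ (r F , d″) ∷ []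

    apart : ∀ {x y : Fin 3} {k l : Fin n} → x ≢ y → (x , k) ≢ (y , l)
    apart ne = ne ∘ cong proj₁

    indices : ∀ {x y : Fin 3} {k l : Fin n} → k ≢ l → (x , k) ≢ (y , l)
    indices ne = ne ∘ cong proj₂

    distinct : Unique vs
    distinct =
        (apart qr ∷ apart qp ∷ apart qr ∷ indices (≢-sym b≢b′) ∷ apart qp ∷ apart qr ∷ [])
      ∷ (apart rp ∷ indices (≢-sym d≢d′) ∷ apart rq ∷ apart rp ∷ indices d′≢d″ ∷ [])
      ∷ (apart (p≢r F) ∷ apart (p≢q F) ∷ indices a≢a′ ∷ apart (p≢r F) ∷ [])
      ∷ (apart rq ∷ apart rp ∷ indices d≢d″ ∷ [])
      ∷ (apart qp ∷ apart qr ∷ [])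
      ∷ (apart (p≢r F) ∷ [])
      ∷ [] ∷ []
      where
      qr = q≢r F
      rq = ≢-sym qr
      qp = ≢-sym (p≢q F)
      rp = ≢-sym (p≢r F)

  path-middle : ∀ F → a ≢ a′ → b ≢ b′ → d ≢ d′ → d ≢ d″ → d′ ≢ d″ →
    color F a b′ d′ ≡ κ → color F a′ b d″ ≡ μ → κ ≢ μ →
    color F a b d ≡ κ ⊎ color F a b d ≡ μ
  path-middle F n₁ n₂ n₃ n₄ n₅ refl refl = middle-color (path-not-rainbow F n₁ n₂ n₃ n₄ n₅)

  path-last : ∀ F → a ≢ a′ → b ≢ b′ → d ≢ d′ → d ≢ d″ → d′ ≢ d″ →
    color F a b′ d′ ≡ κ → color F a b d ≡ μ → κ ≢ μ →
    color F a′ b d″ ≡ κ ⊎ color F a′ b d″ ≡ μ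
  path-last F n₁ n₂ n₃ n₄ n₅ refl refl = last-color (path-not-rainbow F n₁ n₂ n₃ n₄ n₅)

  -- Spreading the third color around a two-colored line.

  record Line (F : Frame n) (u v i j : Fin n) (α β δ : ℕ) : Set where
    constructor line
    field
      first   : color F u v i ≡ α
      second  : color F u v j ≡ β
      α≢β     : α ≢ β
      α≢δ     : α ≢ δ
      β≢δ     : β ≢ δ
      {s₀ t₀ w₀} : Fin n
      s≢u     : s₀ ≢ u
      t≢v     : t₀ ≢ v
      far     : color F s₀ t₀ w₀ ≡ δ

  open Line

  reverse : Line F u v i j α β δ → Line F u v j i β α δ
  reverse L = line (second L) (first L) (≢-sym (α≢β L)) (β≢δ L) (α≢δ L) (s≢u L) (t≢v L) (far L)

  transpose : Line F u v i j α β δ → Line (swap₁₂ F) v u i j α β δ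
  transpose L = line (first L) (second L) (α≢β L) (α≢δ L) (β≢δ L) (t≢v L) (s≢u L) (far L)

  i≢j : Line F u v i j α β δ → i ≢ j
  i≢j L refl = α≢β L (trans (sym (first L)) (second L))

  -- flip changes one coordinate and exchanges the layers i and j, so iterating it reaches only
  -- half of the edges of these two layers; interior gets the other half through wall.
  flip : Line F u v i j α β δ → s ≢ u → t ≢ v → w ≢ v → w ≢ t →
    color F s t i ≡ δ → color F s w j ≡ δ
  flip {F = F} L su tv wv wt st = common (α≢β L)
    (path-last G (i≢j L) su tv (≢-sym wt) (≢-sym wv) (first L) st (α≢δ L))
    (path-middle G (≢-sym (i≢j L)) su wv wt (≢-sym tv) (second L) st (β≢δ L))
    where G = swap₁₂ (swap₂₃ F)

  -- Starting point for `flip`, which needs an edge of color δ in layer i or j, whereas `far` may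
  -- lie in any layer.
  seed : Line F u v i j α β δ → ∃[ s ] ∃[ t ] (s ≢ u × t ≢ v × color F s t i ≡ δ)
  seed {F} {u} {v} {i} {j} {δ = δ} L with locate (w₀ L) i j | fresh n≥3 v (t₀ L)
  ... | inj₁ refl        | _ = _ , _ , s≢u L , t≢v L , far L
  ... | inj₂ (inj₁ refl) | t′ , t′v , t′t =
    _ , t′ , s≢u L , t′v , flip (reverse L) (s≢u L) (t≢v L) t′v t′t (far L)
  -- From any other layer, δ first passes to (u, t′, w₀), and from there to (s₀, t′, i).
  ... | inj₂ (inj₂ (wi , wj)) | t′ , t′v , t′t = s₀ L , t′ , s≢u L , t′v , common (α≢β L)
    (path-middle (swap₁₂ (swap₂₃ F)) (≢-sym wi) (s≢u L) t′v t′t (≢-sym (t≢v L))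
      (first L) (far L) (α≢δ L))
    (path-last F (≢-sym (s≢u L)) t′v wj wi (≢-sym (i≢j L)) (second L) u-t′-w (β≢δ L))
    where
    u-t′-w : color F u t′ (w₀ L) ≡ δ
    u-t′-w = common (α≢β L)
      (path-middle (swap₂₃ F) (≢-sym (s≢u L)) wi t′v t′t (≢-sym (t≢v L)) (first L) (far L) (α≢δ L))
      (path-middle (swap₂₃ F) (≢-sym (s≢u L)) wj t′v t′t (≢-sym (t≢v L)) (second L) (far L) (β≢δ L))

  -- Supplies the end edges of the paths in `wall`: every row t ≢ v has δ in both layers.
  balanced : Line F u v i j α β δ → t ≢ v →
    (∃[ s ] (s ≢ u × color F s t i ≡ δ)) × ∃[ s ] (s ≢ u × color F s t j ≡ δ)
  balanced {u = u} {t = t} L tv with seed L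
  ... | s₀ , t₀ , s₀u , t₀v , st with fresh n≥3 u s₀
  ... | s₁ , s₁u , s₁s₀ with t ≟ t₀
  ... | yes refl = (s₀ , s₀u , st) , s₁ , s₁u , flip (transpose L) tv s₀u s₁u s₁s₀ st
  -- Layer i takes two flips, the first moving s₀ to s₁ and the second t₀ to t; layer j takes one.
  ... | no tt₀   = (s₁ , s₁u , flip (reverse L) s₁u t₀v tv tt₀
                      (flip (transpose L) t₀v s₀u s₁u s₁s₀ st))
                 , s₀ , s₀u , flip L s₀u t₀v tv tt₀ st

  -- The path that starts at (u, v, i) ends in layer j, and the one that starts at (u, v, j) ends in
  -- layer i; hence both halves of `balanced`.
  wall : Line F u v i j α β δ → t ≢ v → w ≢ i → w ≢ j → color F u t w ≡ δ
  wall {F = F} L tv wi wj with balanced L tv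
  ... | (_ , s₁u , ti) , _ , s₂u , tj = common (α≢β L)
    (path-middle F (≢-sym s₂u) tv wi wj (i≢j L) (first L) tj (α≢δ L))
    (path-middle F (≢-sym s₁u) tv wj wi (≢-sym (i≢j L)) (second L) ti (β≢δ L))

  -- The layers other than i and j come first, from `wall` alone; layers i and j then combine `wall`
  -- with an edge in one of those layers.
  interior : Line F u v i j α β δ → s ≢ u → t ≢ v → color F s t w ≡ δ
  interior {F = F} {u} {v} {i} {j} {δ = δ} {s} {t} {w} L su tv = by-third (locate w i j)
    where
    away : ∀ {t w} → t ≢ v → w ≢ i → w ≢ j → color F s t w ≡ δ
    away {t} tv wi wj with fresh n≥3 v t
    ... | _ , t′v , t′t = common (α≢β L)
      (path-last G (≢-sym su) wi t′v t′t (≢-sym tv) (first L) (wall L t′v wi wj) (α≢δ L))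
      (path-last G (≢-sym su) wj t′v t′t (≢-sym tv) (second L) (wall L t′v wi wj) (β≢δ L))
      where G = swap₂₃ F

    at-second : ∀ {i j α β} → Line F u v i j α β δ →
      (∀ {t w} → t ≢ v → w ≢ i → w ≢ j → color F s t w ≡ δ) → color F s t j ≡ δ
    at-second {i} {j} L away with fresh n≥3 i j | fresh n≥3 v t
    ... | w , wi , wj | t′ , t′v , t′t = common (α≢β L)
      (path-last F (≢-sym su) tv wi wj (i≢j L) (first L) (wall L tv wi wj) (α≢δ L))
      (path-middle (swap₁₂ (swap₂₃ F)) (≢-sym wj) su tv (≢-sym t′t) (≢-sym t′v)
        (second L) (away t′v wi wj) (β≢δ L))

    by-third : w ≡ i ⊎ w ≡ j ⊎ (w ≢ i × w ≢ j) → color F s t w ≡ δ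
    by-third (inj₁ refl)             = at-second (reverse L) λ tv wj wi → away tv wi wj
    by-third (inj₂ (inj₁ refl))      = at-second L away
    by-third (inj₂ (inj₂ (wi , wj))) = away tv wi wj

  -- Since (u, t, i) shares both u and i with (u, v, i), no loose path contains these two edges.
  -- Only the path from (u, v, j) remains, so β cannot be excluded.
  side : Line F u v i j α β δ → t ≢ v → color F u t i ≡ β ⊎ color F u t i ≡ δ
  side {F = F} {v = v} {t = t} L tv with fresh n≥3 v t
  ... | _ , t′v , t′t =
    path-middle (swap₂₃ F) (≢-sym (s≢u L)) (i≢j L) tv (≢-sym t′t) (≢-sym t′v)
      (second L) (interior L (s≢u L) t′v) (β≢δ L)

  -- Reading off the three conclusions from a line.

  at-coords : ∀ F {P : Edge n → Set} → (∀ a b d → P (mk F a b d)) → ∀ e → P e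
  at-coords F {P} h e = subst P (mk-coord F e) (h (coord e (p F)) (coord e (q F)) (coord e (r F)))

  meet-two : ∀ F → d ≢ d′ → ∣ mk F a b d ∩ mk F a b d′ ∣ ≡ 2
  meet-two F d≢d′ = trans (∩-agree F _ _) (cong₂ _+_
    (cong₂ _+_ (agree-≡ (p F) (trans (coord-p F) (sym (coord-p F))))
               (agree-≡ (q F) (trans (coord-q F) (sym (coord-q F)))))
    (agree-≢ (r F) λ eq → d≢d′ (trans (sym (coord-r F)) (trans eq (coord-r F)))))

  Conclusion : Set
  Conclusion = CaseI c ⊎ (CaseII c ⊎ CaseIII c)

  colors-are : Line F u v i j α β δ →
    (∀ a b d → color F a b d ≡ α ⊎ color F a b d ≡ β ⊎ color F a b d ≡ δ) → ColorsAre c α β δ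
  colors-are {F = F} L covered =
    α≢β L , α≢δ L , β≢δ L , (_ , first L) , (_ , second L) , (_ , far L) ,
    at-coords F covered

  -- The new far edge has to avoid i instead of v, so it is taken in layer j, where `interior` gives
  -- it color δ.
  turn : Line F u v i j α β δ → t ≢ v → color F u t i ≡ β → Line (swap₂₃ F) u i v t α β δ
  turn {v = v} {t = t} L tv ut with fresh n≥3 v t
  ... | _ , t′v , _ = line (first L) ut (α≢β L) (α≢δ L) (β≢δ L)
    (s≢u L) (≢-sym (i≢j L)) (interior L (s≢u L) t′v)

  module Corner (L : Line F u v i j α β δ) (t≢v : t ≢ v) (ut : color F u t i ≡ β) where
    private
      L↱ : Line (swap₂₃ F) u i v t α β δ
      L↱ = turn L t≢v ut

    case-ii : color F u t j ≡ δ → CaseII c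
    case-ii ut′ = α , β , δ , colors-are L covered , mk F u v i , first L ,
      at-coords F unique , at-coords F nearby
      where
      -- Edges sorted by the number of vertices shared with (u, v, i): three, two, at most one.
      data Position (a b d : Fin n) : Set where
        centre : mk F a b d ≡ mk F u v i → Position a b d
        near   : ∣ mk F u v i ∩ mk F a b d ∣ ≡ 2 → color F a b d ≡ β ⊎ color F a b d ≡ δ →
                 Position a b d
        beyond : color F a b d ≡ δ → Position a b d

      -- The walls of `L` and `L↱` together miss only (u, t, j), which is where the case hypothesis
      -- enters.
      in-plane : ∀ b d → b ≢ v → d ≢ i → color F u b d ≡ δ
      in-plane b d bv di with b ≟ t | d ≟ j
      ... | yes refl | yes refl = ut′
      ... | no bt    | _        = wall L↱ di bv bt
      ... | _        | no dj    = wall L bv di dj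

      position : ∀ a b d → Position a b d
      position a b d with a ≟ u | b ≟ v | d ≟ i
      ... | yes refl | yes refl | yes refl = centre refl
      ... | yes refl | yes refl | no di    = near (meet-two F (≢-sym di)) (side L↱ di)
      ... | yes refl | no bv    | yes refl = near (meet-two (swap₂₃ F) (≢-sym bv)) (side L bv)
      ... | no au    | yes refl | yes refl =
        near (meet-two (swap₂₃ (swap₁₂ F)) (≢-sym au)) (side (transpose L) au)
      ... | yes refl | no bv    | no di    = beyond (in-plane b d bv di)
      ... | no au    | no bv    | _        = beyond (interior L au bv)
      ... | no au    | yes refl | no di    = beyond (interior L↱ au di)

      covered : ∀ a b d → color F a b d ≡ α ⊎ color F a b d ≡ β ⊎ color F a b d ≡ δ
      covered a b d with position a b d
      ... | centre eq = inj₁ (trans (cong c eq) (first L))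
      ... | near _ k  = inj₂ k
      ... | beyond k  = inj₂ (inj₂ k)

      unique : ∀ a b d → color F a b d ≡ α → mk F a b d ≡ mk F u v i
      unique a b d k with position a b d
      ... | centre eq        = eq
      ... | near _ (inj₁ k′) = contradiction (trans (sym k) k′) (α≢β L)
      ... | near _ (inj₂ k′) = contradiction (trans (sym k) k′) (α≢δ L)
      ... | beyond k′        = contradiction (trans (sym k) k′) (α≢δ L)

      nearby : ∀ a b d → color F a b d ≡ β → ∣ mk F u v i ∩ mk F a b d ∣ ≡ 2
      nearby a b d k with position a b d
      ... | centre eq = contradiction (trans (sym (first L)) (trans (sym (cong c eq)) k)) (α≢β L)
      ... | near m _  = m
      ... | beyond k′ = contradiction (trans (sym k) k′) (β≢δ L)

    case-iii : color F u t j ≡ α → CaseIII c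
    case-iii ut′ = α , β , δ , colors-are L covered ,
      (p F , u) , (q F , v) , (q F , t) , (r F , i) , (r F , j) ,
      mk F u v i , mk F u t j , mk F u v j , mk F u t i ,
      spans , spans , spans , spans , first L , ut′ , second L , ut ,
      at-coords F λ a b d → elsewhere (position a b d)
      where
      spans : Spans (mk F a b d) (p F , a) (q F , b) (r F , d)
      spans = p≢q F , p≢r F , q≢r F , coord-p F , coord-q F , coord-r F

      -- `L`, `L⇈`, `L↱` and `L⇉` run along the four sides of the square with rows v, t and layers
      -- i, j in the plane of u. The wall of each side gives δ on the extension of the opposite
      -- side.
      L⇈ : Line F u t i j β α δ
      L⇈ with fresh n≥3 v t
      ... | _ , t′v , t′t = line ut ut′ (≢-sym (α≢β L)) (β≢δ L) (α≢δ L)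
        (s≢u L) t′t (interior {w = i} L (s≢u L) t′v)

      L⇉ : Line (swap₂₃ F) u j v t β α δ
      L⇉ = turn (reverse L) t≢v ut′

      data Position (a b d : Fin n) : Set where
        vi : mk F a b d ≡ mk F u v i → Position a b d
        tj : mk F a b d ≡ mk F u t j → Position a b d
        vj : mk F a b d ≡ mk F u v j → Position a b d
        ti : mk F a b d ≡ mk F u t i → Position a b d
        off : color F a b d ≡ δ → Position a b d

      position : ∀ a b d → Position a b d
      position a b d with a ≟ u | locate b v t | locate d i j
      ... | yes refl | inj₁ refl            | inj₁ refl            = vi refl
      ... | yes refl | inj₁ refl            | inj₂ (inj₁ refl)     = vj refl
      ... | yes refl | inj₂ (inj₁ refl)     | inj₁ refl            = ti refl
      ... | yes refl | inj₂ (inj₁ refl)     | inj₂ (inj₁ refl)     = tj refl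
      ... | yes refl | inj₁ refl            | inj₂ (inj₂ (di , dj)) =
        off (wall L⇈ (≢-sym t≢v) di dj)
      ... | yes refl | inj₂ (inj₁ refl)     | inj₂ (inj₂ (di , dj)) = off (wall L t≢v di dj)
      ... | yes refl | inj₂ (inj₂ (bv , bt)) | inj₁ refl            = off (wall L⇉ (i≢j L) bv bt)
      ... | yes refl | inj₂ (inj₂ (bv , bt)) | inj₂ (inj₁ refl) =
        off (wall L↱ (≢-sym (i≢j L)) bv bt)
      ... | yes refl | inj₂ (inj₂ (bv , bt)) | inj₂ (inj₂ (di , dj)) = off (wall L bv di dj)
      ... | no au    | inj₁ refl            | _ =
        off (interior L⇈ au (≢-sym t≢v))
      ... | no au    | inj₂ (inj₁ refl)     | _                    = off (interior L au t≢v)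
      ... | no au    | inj₂ (inj₂ (bv , _)) | _                    = off (interior L au bv)

      covered : ∀ a b d → color F a b d ≡ α ⊎ color F a b d ≡ β ⊎ color F a b d ≡ δ
      covered a b d with position a b d
      ... | vi eq = inj₁ (trans (cong c eq) (first L))
      ... | tj eq = inj₁ (trans (cong c eq) ut′)
      ... | vj eq = inj₂ (inj₁ (trans (cong c eq) (second L)))
      ... | ti eq = inj₂ (inj₁ (trans (cong c eq) ut))
      ... | off k = inj₂ (inj₂ k)

      elsewhere : Position a b d → mk F a b d ≢ mk F u v i → mk F a b d ≢ mk F u t j →
        mk F a b d ≢ mk F u v j → mk F a b d ≢ mk F u t i → color F a b d ≡ δ
      elsewhere (vi eq) n₁ _ _ _ = contradiction eq n₁
      elsewhere (tj eq) _ n₂ _ _ = contradiction eq n₂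
      elsewhere (vj eq) _ _ n₃ _ = contradiction eq n₃
      elsewhere (ti eq) _ _ _ n₄ = contradiction eq n₄
      elsewhere (off k) _ _ _ _  = k

  second-line : Line F u v i j α β δ → t ≢ v → color F u t i ≢ δ → Conclusion
  second-line {F = F} {u = u} {j = j} {δ = δ} {t = t} L tv uti≢δ with side L tv
  ... | inj₂ k = contradiction k uti≢δ
  ... | inj₁ k with color F u t j ℕ.≟ δ
  ...   | yes k′ = inj₂ (inj₁ (Corner.case-ii L tv k k′))
  -- Reversing the line exchanges i with j and α with β, so α is the only other color possible at
  -- (u, t, j).
  ...   | no utj≢δ with side (reverse L) tv
  ...     | inj₁ k′ = inj₂ (inj₂ (Corner.case-iii L tv k k′))
  ...     | inj₂ k′ = contradiction k′ utj≢δ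

  -- By `wall`, an exception must lie in layer i or j, and reversing the line interchanges these
  -- two.
  in-wall : Line F u v i j α β δ → t ≢ v → color F u t w ≢ δ → Conclusion
  in-wall {i = i} {j} {w = w} L tv k with locate w i j
  ... | inj₁ refl             = second-line L tv k
  ... | inj₂ (inj₁ refl)      = second-line (reverse L) tv k
  ... | inj₂ (inj₂ (wi , wj)) = contradiction (wall L tv wi wj) k

  from-line : Line F u v i j α β δ → Conclusion
  from-line {F} {u} {v} {δ = δ} L
    with any? (λ a → any? λ b → any? λ d →
      ¬? ((a ≟ u) ×-dec (b ≟ v)) ×-dec ¬? (color F a b d ℕ.≟ δ))
  ... | no none = inj₁ ((p F , u) , (q F , v) , δ , p≢q F ∘ cong proj₁ , (_ , far L) ,
      at-coords F on-line)
    where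
    on-line : ∀ a b d → color F a b d ≢ δ → (mk F a b d ∋ (p F , u)) × (mk F a b d ∋ (q F , v))
    on-line a b d k with (a ≟ u) ×-dec (b ≟ v)
    ... | yes (refl , refl) = coord-p F , coord-q F
    ... | no ne = contradiction (a , b , d , ne , k) none
  ... | yes (a , b , d , ne , k) with a ≟ u | b ≟ v
  ...   | yes refl | yes refl = contradiction (refl , refl) ne
  ...   | yes refl | no bv    = in-wall L bv k
  ...   | no au    | yes refl = in-wall (transpose L) au k
  ...   | no au    | no bv    = contradiction (interior L au bv) k

  -- Two disjoint edges of different colors and an edge of a third color.

  record Opposite (F : Frame n) (a₁ b₁ d₁ a₂ b₂ d₂ a₃ b₃ d₃ : Fin n) (α β δ : ℕ) : Set where
    constructor opposite
    field
      first   : color F a₁ b₁ d₁ ≡ α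
      second  : color F a₂ b₂ d₂ ≡ β
      third   : color F a₃ b₃ d₃ ≡ δ
      α≢β     : α ≢ β
      α≢δ     : α ≢ δ
      β≢δ     : β ≢ δ
      a₁≢a₂   : a₁ ≢ a₂
      b₁≢b₂   : b₁ ≢ b₂
      d₁≢d₂   : d₁ ≢ d₂

  opp-swap : Opposite F a₁ b₁ d₁ a₂ b₂ d₂ a₃ b₃ d₃ α β δ →
             Opposite F a₂ b₂ d₂ a₁ b₁ d₁ a₃ b₃ d₃ β α δ
  opp-swap (opposite x y z xy xz yz a b d) =
    opposite y x z (≢-sym xy) yz xz (≢-sym a) (≢-sym b) (≢-sym d)

  opp₁₂ : Opposite F a₁ b₁ d₁ a₂ b₂ d₂ a₃ b₃ d₃ α β δ →
          Opposite (swap₁₂ F) b₁ a₁ d₁ b₂ a₂ d₂ b₃ a₃ d₃ α β δ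
  opp₁₂ (opposite x y z xy xz yz a b d) = opposite x y z xy xz yz b a d

  opp₂₃ : Opposite F a₁ b₁ d₁ a₂ b₂ d₂ a₃ b₃ d₃ α β δ →
          Opposite (swap₂₃ F) a₁ d₁ b₁ a₂ d₂ b₂ a₃ d₃ b₃ α β δ
  opp₂₃ (opposite x y z xy xz yz a b d) = opposite x y z xy xz yz a d b

  -- The first and third edges lie on a common line, and the second serves as its far edge.
  share-two : Opposite F a₁ b₁ d₁ a₂ b₂ d₂ a₁ b₁ d₃ α β δ → Conclusion
  share-two {F} (opposite x y z xy xz yz a b d) =
    from-line {F = F} (line x z xz xy (≢-sym yz) (≢-sym a) (≢-sym b) y)

  -- An impossible case: the third edge is the middle of a rainbow loose path joining the other two.
  share-one-each : Opposite F a₁ b₁ d₁ a₂ b₂ d₂ a₁ b₂ d₃ α β δ → d₃ ≢ d₁ → d₃ ≢ d₂ → Conclusion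
  share-one-each {F} (opposite x y z xy xz yz a b d) n₁ n₂
    with path-middle F a (≢-sym b) n₁ n₂ d x y xy
  ... | inj₁ k = contradiction (trans (sym k) z) xz
  ... | inj₂ k = contradiction (trans (sym k) z) yz

  -- For a new vertex a, paths through the given edges make (a, b₂, ∗) a line with color δ at d₃ and
  -- α at d₁, while (a₂, b₁, d₃) becomes its far edge of color β.
  share-one : Opposite F a₁ b₁ d₁ a₂ b₂ d₂ a₁ b₃ d₃ α β δ →
    b₃ ≢ b₁ → b₃ ≢ b₂ → d₃ ≢ d₁ → d₃ ≢ d₂ → Conclusion
  share-one {F} {a₁ = a₁} {b₁} {d₁} {a₂} {b₂} {d₂} {b₃} {d₃} {α} {β} {δ}
    (opposite x y z xy xz yz a₁₂ b₁₂ d₁₂) b₃₁ b₃₂ d₃₁ d₃₂ with fresh n≥3 a₁ a₂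
  ... | a , a≢₁ , a≢₂ = from-line {F = F} (line near-third near-first (≢-sym xz) (≢-sym yz) xy
      (≢-sym a≢₂) b₁₂ opposite-color)
    where
    near-third : color F a b₂ d₃ ≡ δ
    near-third = common xy
      (path-last (swap₂₃ F) (≢-sym a≢₁) d₃₁ b₃₁ b₃₂ b₁₂ x z xz)
      (path-middle (swap₂₃ (swap₁₂ F)) (≢-sym b₃₂) d₃₂ a≢₂ a≢₁ (≢-sym a₁₂) y z yz)

    near-first : color F a b₂ d₁ ≡ α
    near-first = common yz
      (path-middle (swap₂₃ (swap₁₂ F)) (≢-sym b₁₂) d₁₂ a≢₂ a≢₁ (≢-sym a₁₂) y x (≢-sym xy))
      (path-last (swap₂₃ F) (≢-sym a≢₁) (≢-sym d₃₁) (≢-sym b₃₁) b₁₂ b₃₂ z x (≢-sym xz))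

    opposite-color : color F a₂ b₁ d₃ ≡ β
    opposite-color = common xz
      (path-middle (swap₁₂ F) b₁₂ (≢-sym a₁₂) d₃₁ d₃₂ d₁₂ x y xy)
      (path-middle (swap₁₂ (swap₂₃ F)) d₃₂ (≢-sym a₁₂) (≢-sym b₃₁) b₁₂ b₃₂ z y (≢-sym yz))

  -- Also impossible: (a₁, b₂, d₃) takes one vertex from each of three pairwise disjoint edges, so
  -- it is the middle of a path between any two of them, and no color lies in all three pairs.
  share-none : Opposite F a₁ b₁ d₁ a₂ b₂ d₂ a₃ b₃ d₃ α β δ →
    a₃ ≢ a₁ → a₃ ≢ a₂ → b₃ ≢ b₁ → b₃ ≢ b₂ → d₃ ≢ d₁ → d₃ ≢ d₂ → Conclusion
  share-none {F} (opposite x y z xy xz yz a₁₂ b₁₂ d₁₂) a₃₁ a₃₂ b₃₁ b₃₂ d₃₁ d₃₂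
    with path-middle (swap₂₃ F) (≢-sym a₃₁) d₃₁ (≢-sym b₁₂) (≢-sym b₃₂) (≢-sym b₃₁) x z xz
       | common xz
           (path-middle F a₁₂ (≢-sym b₁₂) d₃₁ d₃₂ d₁₂ x y xy)
           (path-middle (swap₁₂ (swap₂₃ (swap₁₂ F))) d₃₂ (≢-sym b₃₂) (≢-sym a₃₁) a₁₂ a₃₂
             z y (≢-sym yz))
  ... | inj₁ k | k′ = contradiction (trans (sym k) k′) xy
  ... | inj₂ k | k′ = contradiction (trans (sym k′) k) yz

  -- The cases are sorted by what the third edge shares with the disjoint pair: two vertices with
  -- one of the edges, one with each, one in total, or none. Reordering the parts and exchanging the
  -- pair reduces each to a representative.
  from-opposite : Opposite F a₁ b₁ d₁ a₂ b₂ d₂ a₃ b₃ d₃ α β δ → Conclusion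
  from-opposite {F} {a₁} {b₁} {d₁} {a₂} {b₂} {d₂} {a₃} {b₃} {d₃} O
    with locate a₃ a₁ a₂ | locate b₃ b₁ b₂ | locate d₃ d₁ d₂
  ... | inj₁ refl        | inj₁ refl        | _                = share-two O
  ... | inj₁ refl        | inj₂ (inj₁ refl) | inj₁ refl        = share-two (opp₂₃ O)
  ... | inj₁ refl        | inj₂ (inj₂ _)    | inj₁ refl        = share-two (opp₂₃ O)
  ... | inj₂ (inj₁ refl) | inj₁ refl        | inj₁ refl        = share-two (opp₂₃ (opp₁₂ O))
  ... | inj₂ (inj₂ _)    | inj₁ refl        | inj₁ refl        = share-two (opp₂₃ (opp₁₂ O))
  ... | inj₂ (inj₁ refl) | inj₂ (inj₁ refl) | _                = share-two (opp-swap O)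
  ... | inj₂ (inj₁ refl) | inj₁ refl        | inj₂ (inj₁ refl) = share-two (opp₂₃ (opp-swap O))
  ... | inj₂ (inj₁ refl) | inj₂ (inj₂ _)    | inj₂ (inj₁ refl) = share-two (opp₂₃ (opp-swap O))
  ... | inj₁ refl        | inj₂ (inj₁ refl) | inj₂ (inj₁ refl) =
    share-two (opp₂₃ (opp₁₂ (opp-swap O)))
  ... | inj₂ (inj₂ _)    | inj₂ (inj₁ refl) | inj₂ (inj₁ refl) =
    share-two (opp₂₃ (opp₁₂ (opp-swap O)))
  ... | inj₁ refl        | inj₂ (inj₁ refl) | inj₂ (inj₂ (x , y)) = share-one-each O x y
  ... | inj₂ (inj₁ refl) | inj₁ refl        | inj₂ (inj₂ (x , y)) = share-one-each (opp-swap O) y x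
  ... | inj₁ refl        | inj₂ (inj₂ (x , y)) | inj₂ (inj₁ refl) = share-one-each (opp₂₃ O) x y
  ... | inj₂ (inj₁ refl) | inj₂ (inj₂ (x , y)) | inj₁ refl        =
    share-one-each (opp₂₃ (opp-swap O)) y x
  ... | inj₂ (inj₂ (x , y)) | inj₁ refl        | inj₂ (inj₁ refl) =
    share-one-each (opp₂₃ (opp₁₂ O)) x y
  ... | inj₂ (inj₂ (x , y)) | inj₂ (inj₁ refl) | inj₁ refl        =
    share-one-each (opp₂₃ (opp₁₂ (opp-swap O))) y x
  ... | inj₁ refl | inj₂ (inj₂ (x , y)) | inj₂ (inj₂ (z , w)) = share-one O x y z w
  ... | inj₂ (inj₂ (x , y)) | inj₁ refl | inj₂ (inj₂ (z , w)) = share-one (opp₁₂ O) x y z w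
  ... | inj₂ (inj₂ (x , y)) | inj₂ (inj₂ (z , w)) | inj₁ refl =
    share-one (opp₁₂ (opp₂₃ O)) x y z w
  ... | inj₂ (inj₁ refl) | inj₂ (inj₂ (x , y)) | inj₂ (inj₂ (z , w)) =
    share-one (opp-swap O) y x w z
  ... | inj₂ (inj₂ (x , y)) | inj₂ (inj₁ refl) | inj₂ (inj₂ (z , w)) =
    share-one (opp₁₂ (opp-swap O)) y x w z
  ... | inj₂ (inj₂ (x , y)) | inj₂ (inj₂ (z , w)) | inj₂ (inj₁ refl) =
    share-one (opp₁₂ (opp₂₃ (opp-swap O))) y x w z
  ... | inj₂ (inj₂ (x , y)) | inj₂ (inj₂ (z , w)) | inj₂ (inj₂ (u , v)) = share-none O x y z w u v

  -- Finding the disjoint pair.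

  third-color : ∀ {x y} → c x ≢ c y →
    coord x zero ≢ coord y zero → coord x (suc zero) ≢ coord y (suc zero) →
    coord x (suc (suc zero)) ≢ coord y (suc (suc zero)) →
    ∀ {z} → c x ≢ c z → c y ≢ c z → Conclusion
  third-color xy na nb nd xz yz =
    from-opposite {F = standard} (opposite refl refl refl xy xz yz na nb nd)

  -- An edge disjoint from both x and y differs in color from one of them, which gives the disjoint
  -- pair. The third color comes from z if the new edge repeats the color of x or y, and from y
  -- otherwise.
  rainbow-triple : ∀ {x y z} → c x ≢ c y → c x ≢ c z → c y ≢ c z → Conclusion
  rainbow-triple {x@(a₁ , b₁ , d₁)} {y@(a₂ , b₂ , d₂)} xy xz yz
    with fresh n≥3 a₁ a₂ | fresh n≥3 b₁ b₂ | fresh n≥3 d₁ d₂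
  ... | a , a≢₁ , a≢₂ | b , b≢₁ , b≢₂ | d , d≢₁ , d≢₂
    with c x ℕ.≟ c (a , b , d) | c y ℕ.≟ c (a , b , d)
  ... | yes xh | _ = third-color (λ yh → xy (trans xh (sym yh)))
        (≢-sym a≢₂) (≢-sym b≢₂) (≢-sym d≢₂) yz (λ hz → xz (trans xh hz))
  ... | no xh | yes yh = third-color xh
        (≢-sym a≢₁) (≢-sym b≢₁) (≢-sym d≢₁) xz (λ hz → yz (trans yh hz))
  ... | no xh | no yh = third-color xh
        (≢-sym a≢₁) (≢-sym b≢₁) (≢-sym d≢₁) xy (≢-sym yh)

theorem1p15 : (n : ℕ) → n ≥ 3 → (c : Coloring n) → ¬ RainbowLoosePath c →
    AtLeast3Colors c → CaseI c ⊎ (CaseII c ⊎ CaseIII c)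
theorem1p15 n n≥3 c noPath (_ , _ , _ , ab , ad , bd , (_ , refl) , (_ , refl) , (_ , refl)) =
  rainbow-triple n≥3 c noPath ab ad bd
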